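{- Let $V$ be a finite-dimensional real vector space and $X\subseteq V$ a finite or countable set in which every $2$-dimensional linear subset has fundamental vectors, equipped with a suitable ordering $\gamma_1,\gamma_2,\ldots$, and let $X_m=\{\gamma_1,\ldots,\gamma_m\}$ be an initial segment. Let $U$ be biclosed in $X_m$. Then the closure $\overline{U}$ of $U$ in $X$ is biclosed in $X$, and $\overline{U}\cap X_m=U$.
   Context: $\mathrm{Span}_+$ denotes nonnegative linear combinations. For $Y\subseteq X$, $B\subseteq Y$: closed in $Y$ if $\alpha,\beta\in B$, $\gamma\in\mathrm{Span}_+(\alpha,\beta)\cap Y$ imply $\gamma\in B$; coclosed if $Y\setminus B$ closed; biclosed if both; weakly separable if $\mathrm{Span}_+(B)\cap\mathrm{Span}_+(Y\setminus B)=\{0\}$; $Y$ is clean if every biclosed subset of $Y$ is weakly separable in $Y$. The closure of $U$ in $X$ is the smallest closed subset of $X$ containing $U$. A linear subset is $X\cap L$ for a subspace $L$. A $2$-dimensional linear subset $Y$ has fundamental vectors $\alpha,\beta\in Y$ if $Y\subseteq\mathrm{Span}_+\{\alpha,\beta\}$ and neither $\alpha$ nor $\beta$ lies in the nonnegative span of the other elements of $Y$. $F\subseteq X$ is full if $F\cap\mathrm{Span}\{\alpha,\beta\}=X\cap\mathrm{Span}\{\alpha,\beta\}$ for all $\alpha,\beta\in F$. An ordering with initial segments $X_i=\{\gamma_1,\dots,\gamma_i\}$ is suitable if (1) in every $2$-dimensional linear subset the fundamental vectors precede all its other vectors, and (2) for every $i$ and $\alpha,\beta,\gamma\in X_i$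 there is a full $F\subseteq X$ containing them with $F\cap X_i$ clean.
   Formalization: The zero vector is assumed not to lie in X; without this the claim fails, e.g. for X = {α, β, 0} with α, β independent, ordered α, β, 0, and U = {α} in X_2, whose closure {α, 0} is not coclosed. -}

module Defs where

open import Algebra.Bundles using (CommutativeRing)
open import Algebra.Module.Bundles using (Module)
import Algebra.Properties.CommutativeMonoid.Sum as Sum
open import Data.Fin.Base using (Fin; toℕ)
open import Data.Nat.Base using (ℕ; _<_)
open import Data.Product.Base using (∃; ∃-syntax; _×_; _,_; proj₂)
open import Function.Base using (id)
open import Level using (0ℓ)
open import Relation.Binary.Core using (Rel)
open import Relation.Binary.Definitions using (_Respects_)
open import Relation.Binary.PropositionalEquality.Core using (_≡_)
open import Relation.Binary.Structures using (IsTotalOrder)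
open import Relation.Nullary.Negation.Core using (¬_)
open import Relation.Unary using (Pred; _∈_; _∉_; _⊆_; _≐_; _∩_; _∪_; _∖_; U)

-- A Dedekind-complete ordered field.  Classically this determines the
-- real numbers up to unique isomorphism.
record RealNumbers : Set₁ where
  infix 4 _≤_
  field
    commutativeRing : CommutativeRing 0ℓ 0ℓ

  open CommutativeRing commutativeRing public

  field
    0≉1     : ¬ 0# ≈ 1#
    inverse : ∀ x → ¬ x ≈ 0# → ∃[ y ] x * y ≈ 1#

    _≤_          : Rel Carrier 0ℓ
    isTotalOrder : IsTotalOrder _≈_ _≤_
    +-monoˡ-≤    : ∀ {x y} z → x ≤ y → x + z ≤ y + z
    *-nonNeg     : ∀ {x y} → 0# ≤ x → 0# ≤ y → 0# ≤ x * y

  IsUpperBound : Pred Carrier 0ℓ → Pred Carrier 0ℓ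
  IsUpperBound S b = ∀ {x} → x ∈ S → x ≤ b

  field
    supremum : (S : Pred Carrier 0ℓ) → ∃ S → ∃ (IsUpperBound S) →
               ∃[ s ] (IsUpperBound S s × (∀ {b} → IsUpperBound S b → s ≤ b))

RealVectorSpace : RealNumbers → Set₁
RealVectorSpace ℝ = Module (RealNumbers.commutativeRing ℝ) 0ℓ 0ℓ

data Length : Set where
  finite   : ℕ → Length
  infinite : Length

Position : Length → Set
Position (finite n) = Fin n
Position infinite   = ℕ

-- Positions are counted from zero.
index : ∀ {l} → Position l → ℕ
index {finite n} = toℕ
index {infinite} = id

-- Subsets of V are predicates.  A subset closed in some Y that respects
-- the equality of V respects it too (take α = β in IsClosed), and so does
-- a full subset; hence only subspaces are required to do so explicitly.
module Arrangement (ℝ : RealNumbers) (V : RealVectorSpace ℝ) where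

  open RealNumbers ℝ using (0#; _≈_; _≤_) renaming (Carrier to Scalar)
  open Module V using (Carrierᴹ; _≈ᴹ_; 0ᴹ; _+ᴹ_; _*ₗ_; +ᴹ-commutativeMonoid)
  open Sum +ᴹ-commutativeMonoid using (sum)

  Subset : Set₁
  Subset = Pred Carrierᴹ 0ℓ

  ⟦_⟧ : Carrierᴹ → Subset
  ⟦ α ⟧ x = x ≈ᴹ α

  range : ∀ {n} → (Fin n → Carrierᴹ) → Subset
  range b x = ∃[ i ] x ≈ᴹ b i

  combination : ∀ {n} → (Fin n → Scalar) → (Fin n → Carrierᴹ) → Carrierᴹ
  combination c v = sum (λ i → c i *ₗ v i)

  Span : Subset → Subset
  Span S x = ∃[ n ] ∃[ c ] ∃[ v ]
    ((∀ (i : Fin n) → v i ∈ S) × x ≈ᴹ combination c v)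

  Span₊ : Subset → Subset
  Span₊ S x = ∃[ n ] ∃[ c ] ∃[ v ]
    ((∀ (i : Fin n) → 0# ≤ c i) × (∀ i → v i ∈ S) × x ≈ᴹ combination c v)

  LinearlyIndependent : ∀ {n} → (Fin n → Carrierᴹ) → Set
  LinearlyIndependent b = ∀ c → combination c b ≈ᴹ 0ᴹ → ∀ i → c i ≈ 0#

  -- The dimension of a subset is that of its linear span.
  HasDimension : Subset → ℕ → Set
  HasDimension S n = ∃[ b ]
    ((∀ (i : Fin n) → b i ∈ Span S) × LinearlyIndependent b × Span S ⊆ Span (range b))

  FiniteDimensional : Set
  FiniteDimensional = ∃[ n ] HasDimension U n

  record IsSubspace (L : Subset) : Set where
    field
      respects  : L Respects _≈ᴹ_
      0-closed  : 0ᴹ ∈ L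
      +-closed  : ∀ {x y} → x ∈ L → y ∈ L → x +ᴹ y ∈ L
      *ₗ-closed : ∀ a {x} → x ∈ L → a *ₗ x ∈ L

  IsLinearSubset : Subset → Subset → Set₁
  IsLinearSubset X Y = ∃[ L ] (IsSubspace L × Y ≐ X ∩ L)

  AreFundamental : Subset → Carrierᴹ → Carrierᴹ → Set
  AreFundamental Y α β =
    α ∈ Y × β ∈ Y × Y ⊆ Span₊ (⟦ α ⟧ ∪ ⟦ β ⟧) ×
    α ∉ Span₊ (Y ∖ ⟦ α ⟧) × β ∉ Span₊ (Y ∖ ⟦ β ⟧)

  PlanesHaveFundamentalVectors : Subset → Set₁
  PlanesHaveFundamentalVectors X =
    ∀ Y → IsLinearSubset X Y → HasDimension Y 2 → ∃[ α ] ∃[ β ] AreFundamental Y α β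

  IsClosed : Subset → Subset → Set
  IsClosed Y B = B ⊆ Y ×
    (∀ {α β γ} → α ∈ B → β ∈ B → γ ∈ Span₊ (⟦ α ⟧ ∪ ⟦ β ⟧) ∩ Y → γ ∈ B)

  IsCoclosed : Subset → Subset → Set
  IsCoclosed Y B = B ⊆ Y × IsClosed Y (Y ∖ B)

  IsBiclosed : Subset → Subset → Set
  IsBiclosed Y B = IsClosed Y B × IsCoclosed Y B

  IsWeaklySeparable : Subset → Subset → Set
  IsWeaklySeparable Y B = Span₊ B ∩ Span₊ (Y ∖ B) ≐ ⟦ 0ᴹ ⟧

  IsClean : Subset → Set₁
  IsClean Y = ∀ B → IsBiclosed Y B → IsWeaklySeparable Y B

  IsFull : Subset → Subset → Set
  IsFull X F = F ⊆ X ×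
    (∀ {α β} → α ∈ F → β ∈ F → F ∩ Span (⟦ α ⟧ ∪ ⟦ β ⟧) ≐ X ∩ Span (⟦ α ⟧ ∪ ⟦ β ⟧))

  data Closure (X S : Subset) : Subset where
    base : S ⊆ Closure X S
    step : ∀ {α β γ} → α ∈ Closure X S → β ∈ Closure X S →
           γ ∈ Span₊ (⟦ α ⟧ ∪ ⟦ β ⟧) ∩ X → γ ∈ Closure X S

  IsSmallestClosedContaining : Subset → Subset → Subset → Set₁
  IsSmallestClosedContaining X S C =
    IsClosed X C × S ⊆ C × (∀ D → IsClosed X D → S ⊆ D → C ⊆ D)

  closure-isSmallest : ∀ {X S} → S ⊆ X → IsSmallestClosedContaining X S (Closure X S)
  closure-isSmallest {X} {S} S⊆X = (⊆X , step) , base , λ D → least D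
    where
    ⊆X : Closure X S ⊆ X
    ⊆X (base s)         = S⊆X s
    ⊆X (step _ _ (_ , x)) = x

    least : ∀ D → IsClosed X D → S ⊆ D → Closure X S ⊆ D
    least D closed S⊆D (base s)     = S⊆D s
    least D closed S⊆D (step a b g) =
      proj₂ closed (least D closed S⊆D a) (least D closed S⊆D b) g

  record Ordering (X : Subset) : Set where
    field
      length     : Length
      vector     : Position length → Carrierᴹ
      injective  : ∀ {i j} → vector i ≈ᴹ vector j → i ≡ j
      enumerates : X ≐ (λ x → ∃[ i ] x ≈ᴹ vector i)

    -- The set of the first m vectors; it is all of X once m reaches the
    -- length of a finite ordering.
    Initial : ℕ → Subset
    Initial m x = ∃[ i ] (index i < m × x ≈ᴹ vector i)

    FundamentalsFirst : Set₁
    FundamentalsFirst =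
      ∀ Y → IsLinearSubset X Y → HasDimension Y 2 →
      ∀ i j → AreFundamental Y (vector i) (vector j) →
      ∀ k → vector k ∈ Y → ¬ k ≡ i → ¬ k ≡ j → index i < index k × index j < index k

    LocallyClean : Set₁
    LocallyClean =
      ∀ m {α β γ} → α ∈ Initial m → β ∈ Initial m → γ ∈ Initial m →
      ∃[ F ] (IsFull X F × α ∈ F × β ∈ F × γ ∈ F × IsClean (F ∩ Initial m))

    IsSuitable : Set₁
    IsSuitable = FundamentalsFirst × LocallyClean

-- The set U is extended along the ordering one vector at a time.  When a new
-- vector γ arrives, it is added to U exactly when it lies in Span₊(α, β) for
-- some α, β ∈ U.  If it does, or if it lies in the span of two vectors of the
-- complement, weak separability of U ∩ F for a clean F rules out every
-- obstruction; three vectors suffice to fix F, because fullness puts γ, and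
-- with it the fourth vector, into F.  If γ lies in neither span, the only
-- possible obstruction is some r ∈ U in Span₊(p, γ) with p ∉ U.  Then γ is not
-- fundamental in the plane of p and γ, since otherwise at most one earlier
-- vector would lie there; so both fundamental vectors are earlier, exactly one
-- of them is in U, and comparing slopes in the basis they form contradicts
-- either the closedness of U or the choice of γ.
module Submission where

open import Axiom.ExcludedMiddle using (ExcludedMiddle)
open import Data.Nat.Base using (ℕ)
open import Data.Product.Base using (_×_)
open import Level using (0ℓ)
open import Relation.Unary using (_∉_; _≐_; _∩_)
open import Algebra.Module.Bundles using (Module)
open import Defs

open import Algebra.Bundles using (CommutativeMonoid)
import Algebra.Module.Properties as ModuleProperties
import Algebra.Properties.CommutativeSemigroup as CommutativeSemigroupProperties
import Algebra.Properties.Ring as RingProperties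
import Algebra.Solver.Ring.NaturalCoefficients.Default as SemiringSolver
open import Data.Empty using (⊥)
open import Data.Fin.Base using (Fin; zero; suc)
open import Data.Fin.Properties using (toℕ-injective)
import Data.Nat.Base as ℕ
import Data.Nat.Properties as ℕ
open import Data.Product.Base using (∃-syntax; _,_; proj₁; proj₂)
open import Data.Sum.Base using (_⊎_; inj₁; inj₂)
import Data.Sum.Base as Sum
open import Data.Unit.Base using (⊤; tt)
open import Data.Vec.Functional using ([]; _∷_)
open import Function.Base using (_∘_; id)
open import Relation.Binary.Definitions using (_Respects_)
open import Relation.Binary.PropositionalEquality.Core as ≡ using (_≡_)
import Relation.Binary.Reasoning.Setoid as SetoidReasoning
open import Relation.Binary.Structures using (IsTotalOrder)
open import Relation.Nullary.Decidable.Core using (yes; no; decidable-stable)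
open import Relation.Nullary.Negation.Core using (¬_)
open import Relation.Unary using (Pred; _∈_; _⊆_; _∪_; _∖_)

-- Ordered-field arithmetic.

module OrderedField (ℝ : RealNumbers) where

  open RealNumbers ℝ
  open IsTotalOrder isTotalOrder public
    using (total; antisym; ≲-respˡ-≈; ≲-respʳ-≈)
    renaming (refl to ≤-refl; trans to ≤-trans)
  open RingProperties ring using (-‿distribˡ-*; -‿distribʳ-*; -‿involutive)
  open SetoidReasoning setoid
  open SemiringSolver commutativeSemiring using (solve; _:*_; _:=_)

  +-nonNeg : ∀ {x y} → 0# ≤ x → 0# ≤ y → 0# ≤ x + y
  +-nonNeg {x} {y} 0≤x 0≤y =
    ≤-trans 0≤y (≲-respˡ-≈ (+-identityˡ y) (+-monoˡ-≤ y 0≤x))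

  neg-nonNeg : ∀ {x} → x ≤ 0# → 0# ≤ - x
  neg-nonNeg {x} x≤0 =
    ≲-respˡ-≈ (-‿inverseʳ x) (≲-respʳ-≈ (+-identityˡ (- x)) (+-monoˡ-≤ (- x) x≤0))

  nonPos-*-nonPos : ∀ {x y} → x ≤ 0# → y ≤ 0# → 0# ≤ x * y
  nonPos-*-nonPos {x} {y} x≤0 y≤0 =
    ≲-respʳ-≈ -x*-y≈x*y (*-nonNeg (neg-nonNeg x≤0) (neg-nonNeg y≤0))
    where
    -x*-y≈x*y : - x * - y ≈ x * y
    -x*-y≈x*y = begin
      - x * - y     ≈⟨ -‿distribˡ-* x (- y) ⟨
      - (x * - y)   ≈⟨ -‿cong (-‿distribʳ-* x y) ⟨
      - (- (x * y)) ≈⟨ -‿involutive (x * y) ⟩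
      x * y         ∎

  square-nonNeg : ∀ x → 0# ≤ x * x
  square-nonNeg x = Sum.[ (λ 0≤x → *-nonNeg 0≤x 0≤x) , (λ x≤0 → nonPos-*-nonPos x≤0 x≤0) ]′
    (total 0# x)

  0≤1 : 0# ≤ 1#
  0≤1 = ≲-respʳ-≈ (*-identityˡ 1#) (square-nonNeg 1#)

  ≤⇒difference : ∀ {x y} → x ≤ y → ∃[ d ] (0# ≤ d × x + d ≈ y)
  ≤⇒difference {x} {y} x≤y =
    y + - x , ≲-respˡ-≈ (-‿inverseʳ x) (+-monoˡ-≤ (- x) x≤y) , (begin
      x + (y + - x) ≈⟨ +-congˡ (+-comm y (- x)) ⟩
      x + (- x + y) ≈⟨ +-assoc x (- x) y ⟨
      x + - x + y   ≈⟨ +-congʳ (-‿inverseʳ x) ⟩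
      0# + y        ≈⟨ +-identityˡ y ⟩
      y             ∎)

  nonNeg-sum≈0 : ∀ {x y} → 0# ≤ x → 0# ≤ y → x + y ≈ 0# → x ≈ 0#
  nonNeg-sum≈0 {x} {y} 0≤x 0≤y x+y≈0 = antisym x≤0 0≤x
    where
    x≤0 : x ≤ 0#
    x≤0 = ≲-respˡ-≈ (+-identityˡ x) (≲-respʳ-≈ (trans (+-comm y x) x+y≈0) (+-monoˡ-≤ x 0≤y))

  *≈0⇒≈0 : ∀ {x y} → ¬ x ≈ 0# → x * y ≈ 0# → y ≈ 0#
  *≈0⇒≈0 {x} {y} x≉0 xy≈0 with i , xi≈1 ← inverse x x≉0 = begin
    y           ≈⟨ *-identityˡ y ⟨
    1# * y      ≈⟨ *-congʳ (trans (*-comm i x) xi≈1) ⟨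
    i * x * y   ≈⟨ *-assoc i x y ⟩
    i * (x * y) ≈⟨ *-congˡ xy≈0 ⟩
    i * 0#      ≈⟨ zeroʳ i ⟩
    0#          ∎

  -- The inverse `i` equals `x` times the square `i * i`, which shows its sign.
  inverse-nonNeg : ∀ {x} → 0# ≤ x → ¬ x ≈ 0# → ∃[ i ] (0# ≤ i × x * i ≈ 1#)
  inverse-nonNeg {x} 0≤x x≉0 with i , xi≈1 ← inverse x x≉0 =
    i , ≲-respʳ-≈ xii≈i (*-nonNeg 0≤x (square-nonNeg i)) , xi≈1
    where
    xii≈i : x * (i * i) ≈ i
    xii≈i = begin
      x * (i * i) ≈⟨ *-assoc x i i ⟨
      x * i * i   ≈⟨ *-congʳ xi≈1 ⟩
      1# * i      ≈⟨ *-identityˡ i ⟩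
      i           ∎

  quotient-nonNeg : ∀ {x y} → x ≤ 0# → y ≤ 0# → ¬ y ≈ 0# → ∃[ z ] (0# ≤ z × z * y ≈ x)
  quotient-nonNeg {x} {y} x≤0 y≤0 y≉0 with i , yi≈1 ← inverse y y≉0 =
    -- This is the quotient `x * i`, written as a product of nonnegative factors with the help of
    -- `y * i ≈ 1#`.
    x * y * (i * i) , *-nonNeg (nonPos-*-nonPos x≤0 y≤0) (square-nonNeg i) , (begin
      x * y * (i * i) * y   ≈⟨ solve 3 (λ x y i →
        x :* y :* (i :* i) :* y := x :* (y :* i) :* (y :* i)) refl x y i ⟩
      x * (y * i) * (y * i) ≈⟨ *-cong (*-congˡ yi≈1) yi≈1 ⟩
      x * 1# * 1#           ≈⟨ trans (*-identityʳ _) (*-identityʳ x) ⟩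
      x                     ∎)

-- Linear algebra of two vectors.

module Cones (em : ExcludedMiddle 0ℓ) (ℝ : RealNumbers) (V : RealVectorSpace ℝ) where

  open RealNumbers ℝ hiding (zero) renaming (Carrier to Scalar)
  open OrderedField ℝ
  open Module V
  open Arrangement ℝ V
  open ModuleProperties V using (x≈0⇒x*y≈0; y≈0⇒x*y≈0)
  open CommutativeSemigroupProperties (CommutativeMonoid.commutativeSemigroup +ᴹ-commutativeMonoid)
    using (interchange)
  open SetoidReasoning ≈ᴹ-setoid
  open SemiringSolver commutativeSemiring using (solve; _:+_; _:*_; _:=_)

  by-contradiction : {P : Set} → ¬ ¬ P → P
  by-contradiction = decidable-stable em

  lin : Scalar → Carrierᴹ → Scalar → Carrierᴹ → Carrierᴹ
  lin a α b β = a *ₗ α +ᴹ b *ₗ β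

  lin-congᶜ : ∀ {a a′ b b′ α β} → a ≈ a′ → b ≈ b′ → lin a α b β ≈ᴹ lin a′ α b′ β
  lin-congᶜ a≈a′ b≈b′ = +ᴹ-cong (*ₗ-congʳ a≈a′) (*ₗ-congʳ b≈b′)

  lin-congᵛ : ∀ {a b α α′ β β′} → α ≈ᴹ α′ → β ≈ᴹ β′ → lin a α b β ≈ᴹ lin a α′ b β′
  lin-congᵛ α≈α′ β≈β′ = +ᴹ-cong (*ₗ-congˡ α≈α′) (*ₗ-congˡ β≈β′)

  lin-0ˡ : ∀ b α β → lin 0# α b β ≈ᴹ b *ₗ β
  lin-0ˡ b α β = ≈ᴹ-trans (+ᴹ-congʳ (*ₗ-zeroˡ α)) (+ᴹ-identityˡ (b *ₗ β))

  lin-0ʳ : ∀ a α β → lin a α 0# β ≈ᴹ a *ₗ α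
  lin-0ʳ a α β = ≈ᴹ-trans (+ᴹ-congˡ (*ₗ-zeroˡ β)) (+ᴹ-identityʳ (a *ₗ α))

  lin-+ : ∀ a b c d α β → lin a α b β +ᴹ lin c α d β ≈ᴹ lin (a + c) α (b + d) β
  lin-+ a b c d α β = begin
    lin a α b β +ᴹ lin c α d β                        ≈⟨ interchange _ _ _ _ ⟩
    (a *ₗ α +ᴹ c *ₗ α) +ᴹ (b *ₗ β +ᴹ d *ₗ β)          ≈⟨ +ᴹ-cong (*ₗ-distribʳ α a c) (*ₗ-distribʳ β b d) ⟨
    lin (a + c) α (b + d) β                           ∎

  lin-* : ∀ s a b α β → s *ₗ lin a α b β ≈ᴹ lin (s * a) α (s * b) β
  lin-* s a b α β = begin
    s *ₗ lin a α b β                ≈⟨ *ₗ-distribˡ s _ _ ⟩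
    s *ₗ a *ₗ α +ᴹ s *ₗ b *ₗ β      ≈⟨ +ᴹ-cong (*ₗ-assoc s a α) (*ₗ-assoc s b β) ⟨
    lin (s * a) α (s * b) β         ∎

  lin-lin : ∀ c d a b a′ b′ α β →
            lin c (lin a α b β) d (lin a′ α b′ β) ≈ᴹ lin (c * a + d * a′) α (c * b + d * b′) β
  lin-lin c d a b a′ b′ α β = ≈ᴹ-trans (+ᴹ-cong (lin-* c a b α β) (lin-* d a′ b′ α β)) (lin-+ _ _ _ _ α β)

  *ₗ+lin : ∀ c a b α β → c *ₗ α +ᴹ lin a α b β ≈ᴹ lin (c + a) α b β
  *ₗ+lin c a b α β = ≈ᴹ-trans (≈ᴹ-sym (+ᴹ-assoc _ _ _)) (+ᴹ-congʳ (≈ᴹ-sym (*ₗ-distribʳ α c a)))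

  lin-linʳ : ∀ c d a b α β → lin c α d (lin a α b β) ≈ᴹ lin (c + d * a) α (d * b) β
  lin-linʳ c d a b α β = ≈ᴹ-trans (+ᴹ-congˡ (lin-* d a b α β)) (*ₗ+lin c (d * a) (d * b) α β)

  lin-swap : ∀ a b α β → lin a α b β ≈ᴹ lin b β a α
  lin-swap a b α β = +ᴹ-comm (a *ₗ α) (b *ₗ β)

  scalar≉0 : ∀ {x a α} → ¬ x ≈ᴹ 0ᴹ → x ≈ᴹ a *ₗ α → ¬ a ≈ 0#
  scalar≉0 x≉0 x≈aα a≈0 = x≉0 (≈ᴹ-trans x≈aα (x≈0⇒x*y≈0 a≈0))

  factor : ∀ {t a c x α} → t * a ≈ c → x ≈ᴹ a *ₗ α → c *ₗ α ≈ᴹ t *ₗ x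
  factor {t} {a} {c} {x} {α} ta≈c x≈aα = begin
    c *ₗ α       ≈⟨ *ₗ-congʳ ta≈c ⟨
    (t * a) *ₗ α ≈⟨ *ₗ-assoc t a α ⟩
    t *ₗ a *ₗ α  ≈⟨ *ₗ-congˡ x≈aα ⟨
    t *ₗ x       ∎

  divide : ∀ {i a x α} → a * i ≈ 1# → x ≈ᴹ a *ₗ α → α ≈ᴹ i *ₗ x
  divide {i} {a} {x} {α} ai≈1 x≈aα =
    ≈ᴹ-trans (≈ᴹ-sym (*ₗ-identityˡ α)) (factor (trans (*-comm i a) ai≈1) x≈aα)

  *ₗ≈0⇒≈0 : ∀ {a x} → ¬ x ≈ᴹ 0ᴹ → a *ₗ x ≈ᴹ 0ᴹ → a ≈ 0#
  *ₗ≈0⇒≈0 {a} {x} x≉0 ax≈0 = by-contradiction λ a≉0 →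
    let i , ai≈1 = inverse a a≉0 in
    x≉0 (≈ᴹ-trans (divide ai≈1 (≈ᴹ-refl)) (y≈0⇒x*y≈0 ax≈0))

  -- Planes, cones and rays, and their relation to spans.

  Plane : Carrierᴹ → Carrierᴹ → Subset
  Plane α β x = ∃[ a ] ∃[ b ] x ≈ᴹ lin a α b β

  Cone : Carrierᴹ → Carrierᴹ → Subset
  Cone α β x = ∃[ a ] ∃[ b ] (0# ≤ a × 0# ≤ b × x ≈ᴹ lin a α b β)

  Ray : Carrierᴹ → Subset
  Ray α x = ∃[ a ] (0# ≤ a × x ≈ᴹ a *ₗ α)

  Cone-resp : ∀ {α β} → Cone α β Respects _≈ᴹ_
  Cone-resp x≈y (a , b , 0≤a , 0≤b , eq) = a , b , 0≤a , 0≤b , ≈ᴹ-trans (≈ᴹ-sym x≈y) eq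

  Cone-swap : ∀ {α β} → Cone α β ⊆ Cone β α
  Cone-swap (a , b , 0≤a , 0≤b , eq) = b , a , 0≤b , 0≤a , ≈ᴹ-trans eq (lin-swap a b _ _)

  Ray⊆Cone : ∀ {α β} → Ray α ⊆ Cone α β
  Ray⊆Cone {α} {β} (a , 0≤a , eq) = a , 0# , 0≤a , ≤-refl , ≈ᴹ-trans eq (≈ᴹ-sym (lin-0ʳ a α β))

  ∈Cone : ∀ {α β} → α ∈ Cone α β
  ∈Cone {α} = Ray⊆Cone (1# , 0≤1 , ≈ᴹ-sym (*ₗ-identityˡ α))

  diagonal : ∀ {p q} → q ≈ᴹ p → Cone p q ⊆ Ray p
  diagonal {p} q≈p (a , b , 0≤a , 0≤b , eq) =
    a + b , +-nonNeg 0≤a 0≤b ,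
    ≈ᴹ-trans eq (≈ᴹ-trans (lin-congᵛ ≈ᴹ-refl q≈p) (≈ᴹ-sym (*ₗ-distribʳ p a b)))

  Ray-sym : ∀ {α x} → ¬ x ≈ᴹ 0ᴹ → x ∈ Ray α → α ∈ Ray x
  Ray-sym x≉0 (a , 0≤a , eq) with i , 0≤i , ai≈1 ← inverse-nonNeg 0≤a (scalar≉0 x≉0 eq) =
    i , 0≤i , divide ai≈1 eq

  Cone-ray : ∀ {α β x y} → y ∈ Ray x → x ∈ Cone α β → y ∈ Cone α β
  Cone-ray {α} {β} (s , 0≤s , y≈) (a , b , 0≤a , 0≤b , x≈) =
    s * a , s * b , *-nonNeg 0≤s 0≤a , *-nonNeg 0≤s 0≤b ,
    ≈ᴹ-trans y≈ (≈ᴹ-trans (*ₗ-congˡ x≈) (lin-* s a b α β))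

  -- Induction on the number of terms, done once for both kinds of span: `P` is trivial for `Span`
  -- and nonnegativity for `Span₊`.
  combination∈ : ∀ {P : Pred Scalar 0ℓ} {S C : Subset} → 0ᴹ ∈ C →
                 (∀ {a x y} → P a → x ∈ S → y ∈ C → a *ₗ x +ᴹ y ∈ C) →
                 ∀ {n} (c : Fin n → Scalar) v → (∀ i → P (c i)) → (∀ i → v i ∈ S) →
                 combination c v ∈ C
  combination∈ 0∈C closed {ℕ.zero}  c v Pc v∈S = 0∈C
  combination∈ {P} {S} {C} 0∈C closed {ℕ.suc n} c v Pc v∈S =
    closed (Pc zero) (v∈S zero)
      (combination∈ {P} {S} {C} 0∈C closed (c ∘ suc) (v ∘ suc) (Pc ∘ suc) (v∈S ∘ suc))

  Span⊆ : ∀ {S L} → IsSubspace L → S ⊆ L → Span S ⊆ L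
  Span⊆ {S} {L} L-subspace S⊆L (n , c , v , v∈S , eq) =
    respects (≈ᴹ-sym eq) (combination∈ {λ _ → ⊤} {S} {L} 0-closed
      (λ _ x∈S y∈L → +-closed (*ₗ-closed _ (S⊆L x∈S)) y∈L) c v (λ _ → tt) v∈S)
    where open IsSubspace L-subspace

  Plane-isSubspace : ∀ α β → IsSubspace (Plane α β)
  Plane-isSubspace α β = record
    { respects  = λ { x≈y (a , b , eq) → a , b , ≈ᴹ-trans (≈ᴹ-sym x≈y) eq }
    ; 0-closed  = 0# , 0# , ≈ᴹ-sym (≈ᴹ-trans (lin-0ˡ 0# α β) (*ₗ-zeroˡ β))
    ; +-closed  = λ { (a , b , eq) (c , d , eq′) →
                      a + c , b + d , ≈ᴹ-trans (+ᴹ-cong eq eq′) (lin-+ a b c d α β) }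
    ; *ₗ-closed = λ { s (a , b , eq) → s * a , s * b , ≈ᴹ-trans (*ₗ-congˡ eq) (lin-* s a b α β) }
    }

  Plane⊆Span : ∀ {S : Subset} {α β} → α ∈ S → β ∈ S → Plane α β ⊆ Span S
  Plane⊆Span {α = α} {β} α∈S β∈S (a , b , eq) =
    2 , a ∷ b ∷ [] , α ∷ β ∷ [] , (λ { zero → α∈S ; (suc zero) → β∈S }) ,
    ≈ᴹ-trans eq (+ᴹ-congˡ (≈ᴹ-sym (+ᴹ-identityʳ _)))

  Cone⊆Span₊ : ∀ {S : Subset} {α β} → α ∈ S → β ∈ S → Cone α β ⊆ Span₊ S
  Cone⊆Span₊ {α = α} {β} α∈S β∈S (a , b , 0≤a , 0≤b , eq) =
    2 , a ∷ b ∷ [] , α ∷ β ∷ [] , (λ { zero → 0≤a ; (suc zero) → 0≤b }) ,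
    (λ { zero → α∈S ; (suc zero) → β∈S }) , ≈ᴹ-trans eq (+ᴹ-congˡ (≈ᴹ-sym (+ᴹ-identityʳ _)))

  Span₊-pair⊆Cone : ∀ {α β} → Span₊ (⟦ α ⟧ ∪ ⟦ β ⟧) ⊆ Cone α β
  Span₊-pair⊆Cone {α} {β} (n , c , v , 0≤c , v∈S , eq) =
    Cone-resp (≈ᴹ-sym eq) (combination∈ {0# ≤_} {⟦ α ⟧ ∪ ⟦ β ⟧} {Cone α β}
      (Ray⊆Cone (0# , ≤-refl , ≈ᴹ-sym (*ₗ-zeroˡ α)))
      add c v 0≤c v∈S)
    where
    add : ∀ {a x y} → 0# ≤ a → x ∈ ⟦ α ⟧ ∪ ⟦ β ⟧ → y ∈ Cone α β → a *ₗ x +ᴹ y ∈ Cone α β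
    add {a} 0≤a (inj₁ x≈α) (c , d , 0≤c , 0≤d , eq) =
      a + c , d , +-nonNeg 0≤a 0≤c , 0≤d ,
      ≈ᴹ-trans (+ᴹ-cong (*ₗ-congˡ x≈α) eq) (*ₗ+lin a c d α β)
    add {a} 0≤a (inj₂ x≈β) (c , d , 0≤c , 0≤d , eq) =
      c , a + d , 0≤c , +-nonNeg 0≤a 0≤d , (begin
        _                         ≈⟨ +ᴹ-cong (*ₗ-congˡ x≈β) (≈ᴹ-trans eq (lin-swap c d α β)) ⟩
        a *ₗ β +ᴹ lin d β c α     ≈⟨ *ₗ+lin a d c β α ⟩
        lin (a + d) β c α         ≈⟨ lin-swap (a + d) c β α ⟩
        lin c α (a + d) β         ∎)

  Cone⊆Span₊-pair : ∀ {α β} → Cone α β ⊆ Span₊ (⟦ α ⟧ ∪ ⟦ β ⟧)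
  Cone⊆Span₊-pair {α} {β} = Cone⊆Span₊ {⟦ α ⟧ ∪ ⟦ β ⟧} (inj₁ ≈ᴹ-refl) (inj₂ ≈ᴹ-refl)

  Span₊-mono : ∀ {S T} → S ⊆ T → Span₊ S ⊆ Span₊ T
  Span₊-mono S⊆T (n , c , v , 0≤c , v∈S , eq) = n , c , v , 0≤c , S⊆T ∘ v∈S , eq

  -- Substitution eliminates `γ`, so `x` is expressed by vectors of `S` even when `γ` itself lies
  -- outside `S`.
  nested-cone⊆Span₊ : ∀ {S : Subset} {α β γ ε x} → α ∈ S → β ∈ S → ε ∈ S →
                      γ ∈ Cone α β → x ∈ Cone ε γ → x ∈ Span₊ S
  nested-cone⊆Span₊ {α = α} {β} {γ} {ε} {x} α∈S β∈S ε∈S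
    (a , b , 0≤a , 0≤b , γ≈) (c , d , 0≤c , 0≤d , x≈) =
    3 , c ∷ d * a ∷ d * b ∷ [] , ε ∷ α ∷ β ∷ [] ,
    (λ { zero → 0≤c ; (suc zero) → *-nonNeg 0≤d 0≤a ; (suc (suc zero)) → *-nonNeg 0≤d 0≤b }) ,
    (λ { zero → ε∈S ; (suc zero) → α∈S ; (suc (suc zero)) → β∈S }) , (begin
      x                                       ≈⟨ x≈ ⟩
      c *ₗ ε +ᴹ d *ₗ γ                        ≈⟨ +ᴹ-congˡ (≈ᴹ-trans (*ₗ-congˡ γ≈) (lin-* d a b α β)) ⟩
      c *ₗ ε +ᴹ lin (d * a) α (d * b) β       ≈⟨ +ᴹ-congˡ (+ᴹ-congˡ (+ᴹ-identityʳ _)) ⟨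
      c *ₗ ε +ᴹ ((d * a) *ₗ α +ᴹ ((d * b) *ₗ β +ᴹ 0ᴹ)) ∎)

  -- The hypothesis on d says that x is at most as steep as r in the basis α, β;
  -- it is written without subtraction so that only semiring identities occur.
  less-steep∈Cone : ∀ {α β x r x₁ x₂ r₁ r₂ d} → 0# ≤ x₂ → 0# ≤ r₂ → ¬ r₂ ≈ 0# →
                    x ≈ᴹ lin x₁ α x₂ β → r ≈ᴹ lin r₁ α r₂ β →
                    0# ≤ d → x₂ * r₁ + d ≈ x₁ * r₂ → x ∈ Cone α r
  less-steep∈Cone {α} {β} {x} {r} {x₁} {x₂} {r₁} {r₂} {d} 0≤x₂ 0≤r₂ r₂≉0 x≈ r≈ 0≤d det
    with i , 0≤i , r₂i≈1 ← inverse-nonNeg 0≤r₂ r₂≉0 =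
    d * i , x₂ * i , *-nonNeg 0≤d 0≤i , *-nonNeg 0≤x₂ 0≤i , ≈ᴹ-sym (begin
      lin (d * i) α (x₂ * i) r                            ≈⟨ lin-congᵛ ≈ᴹ-refl r≈ ⟩
      lin (d * i) α (x₂ * i) (lin r₁ α r₂ β)              ≈⟨ lin-linʳ _ _ _ _ α β ⟩
      lin (d * i + x₂ * i * r₁) α (x₂ * i * r₂) β         ≈⟨ lin-congᶜ first second ⟩
      lin x₁ α x₂ β                                       ≈⟨ x≈ ⟨
      x                                                   ∎)
    where
    first : d * i + x₂ * i * r₁ ≈ x₁
    first = trans (solve 4 (λ d i x₂ r₁ → d :* i :+ x₂ :* i :* r₁ := (x₂ :* r₁ :+ d) :* i) refl d i x₂ r₁)
      (trans (*-congʳ det) (trans (*-assoc x₁ r₂ i) (trans (*-congˡ r₂i≈1) (*-identityʳ x₁))))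
    second : x₂ * i * r₂ ≈ x₂
    second = trans (solve 3 (λ x₂ i r₂ → x₂ :* i :* r₂ := x₂ :* (r₂ :* i)) refl x₂ i r₂)
      (trans (*-congˡ r₂i≈1) (*-identityʳ x₂))

  -- A vector between `p` and `q` is at least as steep, relative to `α`, as one of them; that one
  -- then lies between `α` and `r`.
  between∈Cone : ∀ {α β p q r} → ¬ r ≈ᴹ 0ᴹ → p ∈ Cone α β → q ∈ Cone α β → r ∈ Cone p q →
                 p ∈ Cone α r ⊎ q ∈ Cone α r
  between∈Cone {α} {β} {p} {q} {r} r≉0
    (p₁ , p₂ , 0≤p₁ , 0≤p₂ , p≈) (q₁ , q₂ , 0≤q₁ , 0≤q₂ , q≈) (a , b , 0≤a , 0≤b , r≈apbq)
    with em {a * p₂ + b * q₂ ≈ 0#}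
  ... | no r₂≉0 = Sum.map p-flatter q-flatter (total (p₂ * q₁) (p₁ * q₂))
    where
    r≈ : r ≈ᴹ lin (a * p₁ + b * q₁) α (a * p₂ + b * q₂) β
    r≈ = ≈ᴹ-trans r≈apbq (≈ᴹ-trans (lin-congᵛ p≈ q≈) (lin-lin a b p₁ p₂ q₁ q₂ α β))
    0≤r₂ = +-nonNeg (*-nonNeg 0≤a 0≤p₂) (*-nonNeg 0≤b 0≤q₂)
    p-flatter : p₂ * q₁ ≤ p₁ * q₂ → p ∈ Cone α r
    p-flatter le with d , 0≤d , eq ← ≤⇒difference le =
      -- With `r₁`, `r₂` the coordinates of `r`, the determinant `p₁ r₂ - p₂ r₁` equals
      -- `b (p₁ q₂ - p₂ q₁)`, whence the witness `b * d`; for `q` the factor is `a`.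
      less-steep∈Cone 0≤p₂ 0≤r₂ r₂≉0 p≈ r≈ (*-nonNeg 0≤b 0≤d) (trans
        (solve 6 (λ a b d p₁ p₂ q₁ → p₂ :* (a :* p₁ :+ b :* q₁) :+ b :* d
                                  := p₁ :* (a :* p₂) :+ b :* (p₂ :* q₁ :+ d)) refl a b d p₁ p₂ q₁)
        (trans (+-congˡ (*-congˡ eq))
        (solve 5 (λ a b p₁ p₂ q₂ → p₁ :* (a :* p₂) :+ b :* (p₁ :* q₂)
                                := p₁ :* (a :* p₂ :+ b :* q₂)) refl a b p₁ p₂ q₂)))
    q-flatter : p₁ * q₂ ≤ p₂ * q₁ → q ∈ Cone α r
    q-flatter le with d , 0≤d , eq ← ≤⇒difference le =
      less-steep∈Cone 0≤q₂ 0≤r₂ r₂≉0 q≈ r≈ (*-nonNeg 0≤a 0≤d) (trans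
        (solve 6 (λ a b d p₁ q₁ q₂ → q₂ :* (a :* p₁ :+ b :* q₁) :+ a :* d
                                  := q₁ :* (b :* q₂) :+ a :* (p₁ :* q₂ :+ d)) refl a b d p₁ q₁ q₂)
        (trans (+-congˡ (*-congˡ eq))
        (solve 5 (λ a b p₂ q₁ q₂ → q₁ :* (b :* q₂) :+ a :* (p₂ :* q₁)
                                := q₁ :* (a :* p₂ :+ b :* q₂)) refl a b p₂ q₁ q₂)))
  -- The `β`-coordinate of `r` vanishes, so whichever of `p`, `q` enters with nonzero weight has
  -- none either and lies on the ray of `α`.
  ... | yes r₂≈0 with em {a ≈ 0#}
  ...   | no a≉0 = inj₁ (Ray⊆Cone (p₁ , 0≤p₁ , ≈ᴹ-trans p≈ (≈ᴹ-trans (lin-congᶜ refl p₂≈0) (lin-0ʳ p₁ α β))))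
    where
    p₂≈0 : p₂ ≈ 0#
    p₂≈0 = *≈0⇒≈0 a≉0 (nonNeg-sum≈0 (*-nonNeg 0≤a 0≤p₂) (*-nonNeg 0≤b 0≤q₂) r₂≈0)
  ...   | yes a≈0 = inj₂ (Ray⊆Cone (q₁ , 0≤q₁ , ≈ᴹ-trans q≈ (≈ᴹ-trans (lin-congᶜ refl q₂≈0) (lin-0ʳ q₁ α β))))
    where
    b≉0 : ¬ b ≈ 0#
    b≉0 b≈0 = r≉0 (≈ᴹ-trans r≈apbq (≈ᴹ-trans (lin-congᶜ a≈0 b≈0) (≈ᴹ-trans (lin-0ˡ 0# p q) (*ₗ-zeroˡ q))))
    q₂≈0 : q₂ ≈ 0#
    q₂≈0 = *≈0⇒≈0 b≉0 (nonNeg-sum≈0 (*-nonNeg 0≤b 0≤q₂) (*-nonNeg 0≤a 0≤p₂) (trans (+-comm _ _) r₂≈0))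

  -- Here `r` is `a + b * c` times `p`. If both this factor and `c` are nonpositive, their quotient
  -- makes `q` a nonnegative multiple of `r`; otherwise `r` is on the ray of `p`.
  between-collinear : ∀ {p q r c} → ¬ r ≈ᴹ 0ᴹ → q ≈ᴹ c *ₗ p → r ∈ Cone p q → r ∈ Ray p ⊎ q ∈ Ray r
  between-collinear {p} {q} {r} {c} r≉0 q≈cp (a , b , 0≤a , 0≤b , r≈) =
    cases (total 0# c) (total 0# (a + b * c))
    where
    r≈sp : r ≈ᴹ (a + b * c) *ₗ p
    r≈sp = begin
      r                          ≈⟨ r≈ ⟩
      a *ₗ p +ᴹ b *ₗ q           ≈⟨ +ᴹ-congˡ (≈ᴹ-trans (*ₗ-congˡ q≈cp) (≈ᴹ-sym (*ₗ-assoc b c p))) ⟩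
      a *ₗ p +ᴹ (b * c) *ₗ p     ≈⟨ *ₗ-distribʳ p a (b * c) ⟨
      (a + b * c) *ₗ p           ∎
    cases : 0# ≤ c ⊎ c ≤ 0# → 0# ≤ a + b * c ⊎ a + b * c ≤ 0# → r ∈ Ray p ⊎ q ∈ Ray r
    cases (inj₁ 0≤c) _          = inj₁ (_ , +-nonNeg 0≤a (*-nonNeg 0≤b 0≤c) , r≈sp)
    cases (inj₂ c≤0) (inj₁ 0≤s) = inj₁ (_ , 0≤s , r≈sp)
    cases (inj₂ c≤0) (inj₂ s≤0) =
      let t , 0≤t , ts≈c = quotient-nonNeg c≤0 s≤0 (scalar≉0 r≉0 r≈sp)
      in inj₂ (t , 0≤t , ≈ᴹ-trans q≈cp (factor ts≈c r≈sp))

  -- Independence, dimension and exchange in a plane.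

  non-collinear⇒independent : ∀ {p q} → ¬ p ≈ᴹ 0ᴹ → ¬ (∃[ c ] q ≈ᴹ c *ₗ p) →
                              LinearlyIndependent (p ∷ q ∷ [])
  non-collinear⇒independent {p} {q} p≉0 q∦p c sum≈0 = λ { zero → c₀≈0 ; (suc zero) → c₁≈0 }
    where
    c₀ = c zero
    c₁ = c (suc zero)
    lin≈0 : lin c₀ p c₁ q ≈ᴹ 0ᴹ
    lin≈0 = ≈ᴹ-trans (+ᴹ-congˡ (≈ᴹ-sym (+ᴹ-identityʳ _))) sum≈0
    c₁≈0 : c₁ ≈ 0#
    c₁≈0 = by-contradiction λ c₁≉0 →
      let i , c₁i≈1 = inverse c₁ c₁≉0 in
      q∦p (i * - c₀ , (begin
        q                  ≈⟨ divide c₁i≈1 -c₀p≈c₁q ⟩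
        i *ₗ (- c₀) *ₗ p   ≈⟨ *ₗ-assoc i (- c₀) p ⟨
        (i * - c₀) *ₗ p    ∎))
      where
      -c₀p≈c₁q : (- c₀) *ₗ p ≈ᴹ c₁ *ₗ q
      -c₀p≈c₁q = begin
        (- c₀) *ₗ p                          ≈⟨ +ᴹ-identityʳ _ ⟨
        (- c₀) *ₗ p +ᴹ 0ᴹ                    ≈⟨ +ᴹ-congˡ lin≈0 ⟨
        (- c₀) *ₗ p +ᴹ lin c₀ p c₁ q         ≈⟨ *ₗ+lin (- c₀) c₀ c₁ p q ⟩
        lin (- c₀ + c₀) p c₁ q               ≈⟨ lin-congᶜ (-‿inverseˡ c₀) refl ⟩
        lin 0# p c₁ q                        ≈⟨ lin-0ˡ c₁ p q ⟩
        c₁ *ₗ q                              ∎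
    c₀≈0 : c₀ ≈ 0#
    c₀≈0 = *ₗ≈0⇒≈0 p≉0 (begin
      c₀ *ₗ p            ≈⟨ lin-0ʳ c₀ p q ⟨
      lin c₀ p 0# q      ≈⟨ lin-congᶜ refl c₁≈0 ⟨
      lin c₀ p c₁ q      ≈⟨ lin≈0 ⟩
      0ᴹ                 ∎)

  Cone⊆Plane : ∀ {α β} → Cone α β ⊆ Plane α β
  Cone⊆Plane (a , b , _ , _ , eq) = a , b , eq

  ∈Planeˡ : ∀ {α β} → α ∈ Plane α β
  ∈Planeˡ = Cone⊆Plane ∈Cone

  ∈Planeʳ : ∀ {α β} → β ∈ Plane α β
  ∈Planeʳ = Cone⊆Plane (Cone-swap ∈Cone)

  HasDimension-plane : ∀ {p q} {X : Subset} → p ∈ X → q ∈ X → ¬ p ≈ᴹ 0ᴹ → ¬ (∃[ c ] q ≈ᴹ c *ₗ p) →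
                       HasDimension (X ∩ Plane p q) 2
  HasDimension-plane {p} {q} {X} p∈X q∈X p≉0 q∦p =
    p ∷ q ∷ [] ,
    (λ { zero → Plane⊆Span {X ∩ Plane p q} (p∈X , ∈Planeˡ) (q∈X , ∈Planeʳ) ∈Planeˡ
       ; (suc zero) → Plane⊆Span {X ∩ Plane p q} (p∈X , ∈Planeˡ) (q∈X , ∈Planeʳ) ∈Planeʳ }) ,
    non-collinear⇒independent p≉0 q∦p ,
    Plane⊆Span {range (p ∷ q ∷ [])} (zero , ≈ᴹ-refl) (suc zero , ≈ᴹ-refl)
      ∘ Span⊆ {X ∩ Plane p q} (Plane-isSubspace p q) proj₂

  -- Unless its coefficient vanishes, `δ` can be solved for; fullness then pulls `δ` into any full
  -- set that contains `x` and `ε`, provided `δ` is in `X`.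
  ray-or-exchange : ∀ {x ε δ} → ¬ x ≈ᴹ 0ᴹ → x ∈ Cone ε δ → ε ∈ Ray x ⊎ δ ∈ Plane x ε
  ray-or-exchange {x} {ε} {δ} x≉0 (a , b , 0≤a , 0≤b , x≈) with em {b ≈ 0#}
  ... | yes b≈0 = inj₁ (Ray-sym x≉0 (a , 0≤a , ≈ᴹ-trans x≈ (≈ᴹ-trans (lin-congᶜ refl b≈0) (lin-0ʳ a ε δ))))
  ... | no b≉0 with i , bi≈1 ← inverse b b≉0 = inj₂ (i , - (i * a) , ≈ᴹ-sym (begin
    lin i x (- (i * a)) ε                     ≈⟨ lin-swap i (- (i * a)) x ε ⟩
    lin (- (i * a)) ε i x                     ≈⟨ lin-congᵛ ≈ᴹ-refl x≈ ⟩
    lin (- (i * a)) ε i (lin a ε b δ)         ≈⟨ lin-linʳ _ i a b ε δ ⟩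
    lin (- (i * a) + i * a) ε (i * b) δ       ≈⟨ lin-congᶜ (-‿inverseˡ (i * a)) (trans (*-comm i b) bi≈1) ⟩
    lin 0# ε 1# δ                             ≈⟨ lin-0ˡ 1# ε δ ⟩
    1# *ₗ δ                                   ≈⟨ *ₗ-identityˡ δ ⟩
    δ                                         ∎))

  -- Biclosed, clean and full sets.

  closed : ∀ {Y B} → IsClosed Y B → ∀ {α β γ} → α ∈ B → β ∈ B → γ ∈ Cone α β → γ ∈ Y → γ ∈ B
  closed B-closed α∈B β∈B γ∈Cone γ∈Y = proj₂ B-closed α∈B β∈B (Cone⊆Span₊-pair γ∈Cone , γ∈Y)

  closed-resp : ∀ {Y B} → IsClosed Y B → ∀ {α γ} → α ∈ B → γ ≈ᴹ α → γ ∈ Y → γ ∈ B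
  closed-resp {Y} {B} B-closed {α} α∈B γ≈α =
    closed {Y} {B} B-closed α∈B α∈B (Cone-resp (≈ᴹ-sym γ≈α) ∈Cone)

  -- Excluded middle identifies the double complement with `B`. Results about a biclosed set thereby
  -- apply to its complement.
  complement-biclosed : ∀ {Y B} → IsBiclosed Y B → IsBiclosed Y (Y ∖ B)
  complement-biclosed {Y} {B} ((_ , B-closed) , _ , Bᶜ-closed) =
    Bᶜ-closed , proj₁ , proj₁ , λ { α∉ β∉ γ∈@(_ , γ∈Y) →
      γ∈Y , λ γ∉B → proj₂ γ∉B (B-closed (∈B α∉) (∈B β∉) γ∈) }
    where
    ∈B : Y ∖ (Y ∖ B) ⊆ B
    ∈B (x∈Y , ¬¬x∈B) = by-contradiction λ x∉B → ¬¬x∈B (x∈Y , x∉B)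

  ∩-biclosed : ∀ {Y B} F → IsBiclosed Y B → IsBiclosed (F ∩ Y) (B ∩ F)
  ∩-biclosed {Y} {B} F ((B⊆Y , B-closed) , _ , _ , Bᶜ-closed) =
    (⊆ , λ { (α∈B , _) (β∈B , _) (γ∈Cone , γ∈F , γ∈Y) → B-closed α∈B β∈B (γ∈Cone , γ∈Y) , γ∈F }) ,
    ⊆ , proj₁ , λ { ((α∈F , α∈Y) , α∉) ((β∈F , β∈Y) , β∉) (γ∈Cone , γ∈F , γ∈Y) →
      (γ∈F , γ∈Y) , λ { (γ∈B , _) → proj₂ (Bᶜ-closed (α∈Y , λ α∈B → α∉ (α∈B , α∈F))
                                                       (β∈Y , λ β∈B → β∉ (β∈B , β∈F))
                                                       (γ∈Cone , γ∈Y)) γ∈B } }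
    where
    ⊆ : B ∩ F ⊆ F ∩ Y
    ⊆ (x∈B , x∈F) = x∈F , B⊆Y x∈B

  -- The trace `B ∩ F` is biclosed in `F ∩ Y`, and its complement there contains the part of `Y ∖ B`
  -- in `F`.
  clean⇒separated : ∀ {F Y B} → IsClean (F ∩ Y) → IsBiclosed Y B →
                    ∀ {x} → x ∈ Span₊ (B ∩ F) → x ∈ Span₊ ((Y ∖ B) ∩ F) → x ≈ᴹ 0ᴹ
  clean⇒separated {F} {Y} {B} F-clean B-biclosed x∈ x∈ᶜ =
    proj₁ (F-clean (B ∩ F) (∩-biclosed F B-biclosed))
      (x∈ , Span₊-mono {(Y ∖ B) ∩ F} {(F ∩ Y) ∖ (B ∩ F)}
              (λ { ((y∈Y , y∉B) , y∈F) → (y∈F , y∈Y) , y∉B ∘ proj₁ }) x∈ᶜ)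

  full-plane : ∀ {X F} → IsFull X F → ∀ {α β x} → α ∈ F → β ∈ F → x ∈ X → x ∈ Plane α β → x ∈ F
  full-plane (_ , full) {α} {β} α∈F β∈F x∈X x∈Plane =
    proj₁ (proj₂ (full α∈F β∈F)
      (x∈X , Plane⊆Span {⟦ α ⟧ ∪ ⟦ β ⟧} (inj₁ ≈ᴹ-refl) (inj₂ ≈ᴹ-refl) x∈Plane))

  AreFundamental-resp : ∀ {Y α α′ β β′} → Y Respects _≈ᴹ_ → α ≈ᴹ α′ → β ≈ᴹ β′ →
                        AreFundamental Y α β → AreFundamental Y α′ β′
  AreFundamental-resp {Y} {α} {α′} {β} {β′} Y-resp α≈α′ β≈β′ (α∈Y , β∈Y , Y⊆ , α∉ , β∉) =
    Y-resp α≈α′ α∈Y , Y-resp β≈β′ β∈Y ,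
    Span₊-mono {⟦ α ⟧ ∪ ⟦ β ⟧} {⟦ α′ ⟧ ∪ ⟦ β′ ⟧}
      (Sum.map (λ x≈α → ≈ᴹ-trans x≈α α≈α′) (λ x≈β → ≈ᴹ-trans x≈β β≈β′)) ∘ Y⊆ ,
    apex-resp α≈α′ α∉ , apex-resp β≈β′ β∉
    where
    apex-resp : ∀ {δ δ′} → δ ≈ᴹ δ′ → δ ∉ Span₊ (Y ∖ ⟦ δ ⟧) → δ′ ∉ Span₊ (Y ∖ ⟦ δ′ ⟧)
    apex-resp {δ} {δ′} δ≈δ′ δ∉ (n , c , v , 0≤c , v∈ , eq) =
      δ∉ (Span₊-mono {Y ∖ ⟦ δ′ ⟧} {Y ∖ ⟦ δ ⟧}
        (λ { (x∈Y , x≉δ′) → x∈Y , λ x≈δ → x≉δ′ (≈ᴹ-trans x≈δ δ≈δ′) })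
        (n , c , v , 0≤c , v∈ , ≈ᴹ-trans δ≈δ′ eq))

  AreFundamental-swap : ∀ {Y α β} → AreFundamental Y α β → AreFundamental Y β α
  AreFundamental-swap {Y} {α} {β} (α∈Y , β∈Y , Y⊆ , α∉ , β∉) =
    β∈Y , α∈Y , Span₊-mono {⟦ α ⟧ ∪ ⟦ β ⟧} {⟦ β ⟧ ∪ ⟦ α ⟧} Sum.swap ∘ Y⊆ , β∉ , α∉

index-injective : ∀ {l} {i j : Position l} → index i ≡ index j → i ≡ j
index-injective {finite n} = toℕ-injective
index-injective {infinite} = id

-- The ordered set and its initial segments.

module Extension (em : ExcludedMiddle 0ℓ) (ℝ : RealNumbers) (V : RealVectorSpace ℝ)
  (X : Arrangement.Subset ℝ V) (0∉X : Module.0ᴹ V ∉ X)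
  (planes : Arrangement.PlanesHaveFundamentalVectors ℝ V X)
  (γ : Arrangement.Ordering ℝ V X) (suitable : Arrangement.Ordering.IsSuitable γ) where

  open Arrangement ℝ V
  open Module V
  open Cones em ℝ V
  open Ordering γ

  Initial⊆X : ∀ {m} → Initial m ⊆ X
  Initial⊆X (i , _ , x≈) = proj₂ enumerates (i , x≈)

  Initial-mono : ∀ {m n} → m ℕ.≤ n → Initial m ⊆ Initial n
  Initial-mono m≤n (i , i<m , x≈) = i , ℕ.<-≤-trans i<m m≤n , x≈

  X⊆Initial : ∀ {x} → x ∈ X → ∃[ m ] x ∈ Initial m
  X⊆Initial x∈X with i , x≈ ← proj₁ enumerates x∈X = ℕ.suc (index i) , i , ℕ.≤-refl , x≈

  X-resp : X Respects _≈ᴹ_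
  X-resp x≈y x∈X with i , x≈ ← proj₁ enumerates x∈X =
    proj₂ enumerates (i , ≈ᴹ-trans (≈ᴹ-sym x≈y) x≈)

  -- Weak separability allows `0ᴹ` as a common point, so a contradiction with it must exhibit a
  -- nonzero one.
  X⇒≉0 : ∀ {x} → x ∈ X → ¬ x ≈ᴹ 0ᴹ
  X⇒≉0 x∈X x≈0 = 0∉X (X-resp x≈0 x∈X)

  -- With positions counted from zero, this is what `Initial (ℕ.suc m)` adds to `Initial m`: one
  -- vector, or nothing past the end of a finite ordering.
  Latest : ℕ → Subset
  Latest m x = ∃[ i ] (index i ≡ m × x ≈ᴹ vector i)

  Initial-suc⁻ : ∀ {m x} → x ∈ Initial (ℕ.suc m) → x ∈ Initial m ⊎ x ∈ Latest m
  Initial-suc⁻ (i , i<1+m , x≈) =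
    Sum.map (λ i<m → i , i<m , x≈) (λ i≡m → i , i≡m , x≈) (ℕ.m<1+n⇒m<n∨m≡n i<1+m)

  Latest-unique : ∀ {m x y} → x ∈ Latest m → y ∈ Latest m → x ≈ᴹ y
  Latest-unique (i , i≡m , x≈) (j , j≡m , y≈)
    with ≡.refl ← index-injective {i = i} {j} (≡.trans i≡m (≡.sym j≡m)) = ≈ᴹ-trans x≈ (≈ᴹ-sym y≈)

  -- Consequences of local cleanness.

  module _ {m : ℕ} {U : Subset} (U-biclosed : IsBiclosed (Initial m) U) where

    private
      U-closed = proj₁ U-biclosed
      U⊆ : U ⊆ Initial m
      U⊆ = proj₁ U-closed
      Uᶜ-closed = proj₂ (proj₂ U-biclosed)

    -- A full set through `α`, `β`, `ε` also contains `γ` and then `δ`. Were `δ` outside `U`, this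
    -- nonzero vector would lie in the nonnegative spans of both sides.
    absorb : ∀ {α β γ ε δ} → α ∈ U → β ∈ U → ε ∈ U → γ ∈ X → γ ∈ Cone α β →
             δ ∈ Initial m → δ ∈ Cone ε γ → δ ∈ U
    absorb {γ = γ} {ε} {δ} α∈U β∈U ε∈U γ∈X γ∈Cone δ∈ δ∈Cone
      with F , F-full , α∈F , β∈F , ε∈F , F-clean ← proj₂ suitable m (U⊆ α∈U) (U⊆ β∈U) (U⊆ ε∈U) =
      by-contradiction λ δ∉U → X⇒≉0 (Initial⊆X δ∈)
        (clean⇒separated F-clean U-biclosed
          (nested-cone⊆Span₊ {U ∩ F} (α∈U , α∈F) (β∈U , β∈F) (ε∈U , ε∈F) γ∈Cone δ∈Cone)
          (Cone⊆Span₊ {(Initial m ∖ U) ∩ F} ((δ∈ , δ∉U) , δ∈F) ((δ∈ , δ∉U) , δ∈F) ∈Cone))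
      where
      γ∈F = full-plane F-full α∈F β∈F γ∈X (Cone⊆Plane γ∈Cone)
      δ∈F = full-plane F-full ε∈F γ∈F (Initial⊆X δ∈) (Cone⊆Plane δ∈Cone)

    cones-disjoint : ∀ {α β γ ε δ} → α ∈ U → β ∈ U → γ ∈ X → γ ∈ Cone α β →
                     ε ∈ Initial m ∖ U → δ ∈ Initial m ∖ U → γ ∉ Cone ε δ
    cones-disjoint {γ = γ} {ε} {δ} α∈U β∈U γ∈X γ∈Cone ε∉U δ∉U γ∈Coneᶜ
      with ray-or-exchange (X⇒≉0 γ∈X) γ∈Coneᶜ
    -- Now `ε` lies in `Cone α γ`, so `absorb`, with `α` also as its third vector, puts `ε` into
    -- `U`.
    ... | inj₁ ε∈ray = proj₂ ε∉U (absorb α∈U β∈U α∈U γ∈X γ∈Cone (proj₁ ε∉U) (Cone-swap (Ray⊆Cone ε∈ray)))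
    ... | inj₂ δ∈Plane
      with F , F-full , α∈F , β∈F , ε∈F , F-clean ← proj₂ suitable m (U⊆ α∈U) (U⊆ β∈U) (proj₁ ε∉U) =
      X⇒≉0 γ∈X (clean⇒separated F-clean U-biclosed
        (Cone⊆Span₊ {U ∩ F} (α∈U , α∈F) (β∈U , β∈F) γ∈Cone)
        (Cone⊆Span₊ {(Initial m ∖ U) ∩ F} (ε∉U , ε∈F) (δ∉U , δ∈F) γ∈Coneᶜ))
      where
      γ∈F = full-plane F-full α∈F β∈F γ∈X (Cone⊆Plane γ∈Cone)
      -- After the exchange, `δ` is in the plane of two vectors already known to lie in `F`.
      δ∈F = full-plane F-full γ∈F ε∈F (Initial⊆X (proj₁ δ∉U)) δ∈Plane

  -- Fundamental vectors come first in their plane, so only the second one can precede the first.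
  latest-fundamental : ∀ {Y m i j} → Y Respects _≈ᴹ_ → IsLinearSubset X Y → HasDimension Y 2 →
                       AreFundamental Y (vector i) (vector j) → index i ≡ m →
                       ∀ {x} → x ∈ Y → x ∈ Initial m → x ≈ᴹ vector j
  latest-fundamental {Y} {i = i} {j} Y-resp Y-linear Y-dim fund ≡.refl x∈Y (k , k<i , x≈) =
    by-contradiction λ x≉j →
      ℕ.<-asym k<i (proj₁ (proj₁ suitable Y Y-linear Y-dim i j fund k (Y-resp x≈ x∈Y)
        (λ { ≡.refl → ℕ.<-irrefl ≡.refl k<i })
        (λ { ≡.refl → x≉j x≈ })))

  -- Members of `U` enter with `α` and `β` equal to themselves, and closedness admits no other
  -- vector of `Initial m`. For biclosed `U` the definition thus decides only about the newest
  -- vector, without a case distinction on `x`.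
  extend : ℕ → Subset → Subset
  extend m U x = x ∈ Initial (ℕ.suc m) × ∃[ α ] ∃[ β ] (α ∈ U × β ∈ U × x ∈ Cone α β)

  -- Biclosedness of the one-vector extension.

  module _ {m : ℕ} {U : Subset} (U-biclosed : IsBiclosed (Initial m) U) where

    private
      U-closed = proj₁ U-biclosed
      U⊆ : U ⊆ Initial m
      U⊆ = proj₁ U-closed
      Uᶜ-closed = proj₂ (proj₂ U-biclosed)
      Uᶜ-biclosed = complement-biclosed U-biclosed

    ⊆extend : U ⊆ extend m U
    ⊆extend {x} x∈U = Initial-mono (ℕ.n≤1+n m) (U⊆ x∈U) , x , x , x∈U , x∈U , ∈Cone

    extend∩Initial⊆ : extend m U ∩ Initial m ⊆ U
    extend∩Initial⊆ ((_ , _ , _ , α∈U , β∈U , x∈Cone) , x∈) = closed U-closed α∈U β∈U x∈Cone x∈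

    extend-resp : ∀ {x y} → x ≈ᴹ y → y ∈ Initial (ℕ.suc m) → x ∈ extend m U → y ∈ extend m U
    extend-resp x≈y y∈ (_ , α , β , α∈U , β∈U , x∈Cone) = y∈ , α , β , α∈U , β∈U , Cone-resp x≈y x∈Cone

    -- If `q` is collinear with `p`, signs decide; otherwise the fundamental vectors of the plane of
    -- `p` and `q` do.
    no-obstruction : ∀ {p q r} → p ∈ Initial m ∖ U → q ∈ Latest m → q ∈ Initial (ℕ.suc m) →
                     q ∉ extend m U → r ∈ U → r ∉ Cone p q
    no-obstruction {p} {q} {r} p∉U q-latest q∈ q∉ r∈U r∈Cone with em {∃[ c ] q ≈ᴹ c *ₗ p}
    ... | yes (c , q≈cp) with between-collinear (X⇒≉0 (Initial⊆X (U⊆ r∈U))) q≈cp r∈Cone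
    ...   | inj₁ r∈Ray = proj₂ (closed Uᶜ-closed p∉U p∉U (Ray⊆Cone r∈Ray) (U⊆ r∈U)) r∈U
    ...   | inj₂ q∈Ray = q∉ (q∈ , r , r , r∈U , r∈U , Ray⊆Cone q∈Ray)
    no-obstruction {p} {q} {r} p∉U@(p∈ , _) (k , ≡.refl , q≈) q∈ q∉ r∈U r∈Cone | no q∦p =
      impossible (planes Y Y-linear Y-dim)
      where
      Y : Subset
      Y = X ∩ Plane p q
      Y-resp : Y Respects _≈ᴹ_
      Y-resp x≈y (x∈X , x∈Plane) =
        X-resp x≈y x∈X , IsSubspace.respects (Plane-isSubspace p q) x≈y x∈Plane
      Y-linear : IsLinearSubset X Y
      Y-linear = Plane p q , Plane-isSubspace p q , id , id
      Y-dim : HasDimension Y 2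
      Y-dim = HasDimension-plane (Initial⊆X p∈) (Initial⊆X q∈) (X⇒≉0 (Initial⊆X p∈)) q∦p
      p∈Y : p ∈ Y
      p∈Y = Initial⊆X p∈ , ∈Planeˡ
      q∈Y : q ∈ Y
      q∈Y = Initial⊆X q∈ , ∈Planeʳ
      r∈Y : r ∈ Y
      r∈Y = Initial⊆X (U⊆ r∈U) , Cone⊆Plane r∈Cone
      p≉r : ¬ p ≈ᴹ r
      p≉r p≈r = proj₂ p∉U (closed-resp U-closed r∈U p≈r p∈)

      latest-not-fundamental : ∀ {i j} → AreFundamental Y (vector i) (vector j) → ¬ k ≡ i
      latest-not-fundamental fund ≡.refl =
        -- If `q` were fundamental, the earlier vectors `p` and `r` would both equal the other
        -- fundamental vector.
        p≉r (≈ᴹ-trans (only p∈Y p∈) (≈ᴹ-sym (only r∈Y (U⊆ r∈U))))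
        where
        only = latest-fundamental Y-resp Y-linear Y-dim fund ≡.refl

      -- One of `p`, `q` lies between `α` and `r`: in the case of `p` closedness puts it into `U`,
      -- in the case of `q` into the extension.
      mixed : ∀ {α β} → α ∈ U → p ∈ Cone α β → q ∈ Cone α β → ⊥
      mixed {α} α∈U p∈Cone q∈Cone with between∈Cone (X⇒≉0 (proj₁ r∈Y)) p∈Cone q∈Cone r∈Cone
      ... | inj₁ p∈ = proj₂ p∉U (closed U-closed α∈U r∈U p∈ (proj₁ p∉U))
      ... | inj₂ q∈′ = q∉ (q∈ , α , r , α∈U , r∈U , q∈′)

      earlier : ∀ {i j} → AreFundamental Y (vector i) (vector j) →
                vector i ∈ Initial (index k) → vector j ∈ Initial (index k) → ⊥
      earlier {i} {j} (_ , _ , Y⊆ , _) i∈ j∈ with em {vector i ∈ U} | em {vector j ∈ U}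
      ... | yes i∈U | yes j∈U = q∉ (q∈ , _ , _ , i∈U , j∈U , Span₊-pair⊆Cone (Y⊆ q∈Y))
      ... | yes i∈U | no _    = mixed i∈U (Span₊-pair⊆Cone (Y⊆ p∈Y)) (Span₊-pair⊆Cone (Y⊆ q∈Y))
      ... | no _    | yes j∈U =
        mixed j∈U (Cone-swap (Span₊-pair⊆Cone (Y⊆ p∈Y))) (Cone-swap (Span₊-pair⊆Cone (Y⊆ q∈Y)))
      -- Two vectors of the complement span `q`, so `absorb` for the complement carries `r` out of
      -- `U`.
      ... | no i∉U  | no j∉U  =
        proj₂ (absorb Uᶜ-biclosed (i∈ , i∉U) (j∈ , j∉U) p∉U (proj₁ q∈Y)
          (Span₊-pair⊆Cone (Y⊆ q∈Y)) (U⊆ r∈U) r∈Cone) r∈U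

      impossible : ∃[ α ] ∃[ β ] AreFundamental Y α β → ⊥
      impossible (α , β , fund@((α∈X , _) , (β∈X , _) , _))
        with i , α≈ ← proj₁ enumerates α∈X | j , β≈ ← proj₁ enumerates β∈X =
        earlier fund′ (i , proj₁ i,j<k , ≈ᴹ-refl) (j , proj₂ i,j<k , ≈ᴹ-refl)
        where
        fund′ : AreFundamental Y (vector i) (vector j)
        fund′ = AreFundamental-resp Y-resp α≈ β≈ fund
        i,j<k : index i ℕ.< index k × index j ℕ.< index k
        i,j<k = proj₁ suitable Y Y-linear Y-dim i j fund′ k (Y-resp q≈ q∈Y)
          (latest-not-fundamental fund′) (latest-not-fundamental (AreFundamental-swap fund′))

    extend-closed : IsClosed (Initial (ℕ.suc m)) (extend m U)
    extend-closed = proj₁ , λ { p∈ q∈ (r∈Span , r∈) → cone∈ p∈ q∈ (Span₊-pair⊆Cone r∈Span) r∈ }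
      where
      mixed : ∀ {p q r} → p ∈ U → q ∈ extend m U → r ∈ Cone p q → r ∈ Initial m → r ∈ U
      mixed p∈U (q∈ , _ , _ , α∈U , β∈U , q∈Cone) r∈Cone r∈ =
        absorb U-biclosed α∈U β∈U p∈U (Initial⊆X q∈) q∈Cone r∈ r∈Cone

      cone∈ : ∀ {p q r} → p ∈ extend m U → q ∈ extend m U → r ∈ Cone p q →
              r ∈ Initial (ℕ.suc m) → r ∈ extend m U
      cone∈ {p} {q} p∈′ q∈′ r∈Cone r∈
        with Initial-suc⁻ (proj₁ p∈′) | Initial-suc⁻ (proj₁ q∈′) | Initial-suc⁻ r∈
      ... | inj₁ p∈ | inj₁ q∈ | _ =
        r∈ , p , q , extend∩Initial⊆ (p∈′ , p∈) , extend∩Initial⊆ (q∈′ , q∈) , r∈Cone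
      ... | inj₂ p-latest | _ | inj₂ r-latest = extend-resp (Latest-unique p-latest r-latest) r∈ p∈′
      ... | _ | inj₂ q-latest | inj₂ r-latest = extend-resp (Latest-unique q-latest r-latest) r∈ q∈′
      ... | inj₁ p∈ | inj₂ _ | inj₁ r∈ᵐ =
        ⊆extend (mixed (extend∩Initial⊆ (p∈′ , p∈)) q∈′ r∈Cone r∈ᵐ)
      ... | inj₂ _ | inj₁ q∈ | inj₁ r∈ᵐ =
        ⊆extend (mixed (extend∩Initial⊆ (q∈′ , q∈)) p∈′ (Cone-swap r∈Cone) r∈ᵐ)
      -- Since `p` and `q` coincide, `r` is on the ray of `p`. A generator `α` of `p` serves as the
      -- old vector, because `r` lies in `Cone α p`.
      ... | inj₂ p-latest | inj₂ q-latest | inj₁ r∈ᵐ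
        with _ , _ , _ , α∈U , _ ← p∈′ =
        ⊆extend (mixed α∈U p∈′ (Cone-swap (Ray⊆Cone (diagonal (Latest-unique q-latest p-latest) r∈Cone))) r∈ᵐ)

    extend-coclosed : IsClosed (Initial (ℕ.suc m)) (Initial (ℕ.suc m) ∖ extend m U)
    extend-coclosed = proj₁ , λ { p∉ q∉ (r∈Span , r∈) → r∈ , cone∉ p∉ q∉ (Span₊-pair⊆Cone r∈Span) }
      where
      Uᶜ : ∀ {p} → p ∈ Initial (ℕ.suc m) ∖ extend m U → p ∈ Initial m → p ∈ Initial m ∖ U
      Uᶜ (_ , p∉) p∈ = p∈ , λ p∈U → p∉ (⊆extend p∈U)

      mixed : ∀ {p q r} → p ∈ Initial m ∖ U → q ∈ Latest m → q ∈ Initial (ℕ.suc m) ∖ extend m U →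
              r ∈ Cone p q → r ∉ extend m U
      mixed p∉U q-latest (q∈ , q∉) r∈Cone r∈′ with Initial-suc⁻ (proj₁ r∈′)
      ... | inj₁ r∈       = no-obstruction p∉U q-latest q∈ q∉ (extend∩Initial⊆ (r∈′ , r∈)) r∈Cone
      ... | inj₂ r-latest = q∉ (extend-resp (Latest-unique r-latest q-latest) q∈ r∈′)

      cone∉ : ∀ {p q r} → p ∈ Initial (ℕ.suc m) ∖ extend m U → q ∈ Initial (ℕ.suc m) ∖ extend m U →
              r ∈ Cone p q → r ∉ extend m U
      cone∉ {p} {q} {r} p∉ q∉ r∈Cone r∈′@(r∈ , α , β , α∈U , β∈U , r∈Coneᵁ)
        with Initial-suc⁻ (proj₁ p∉) | Initial-suc⁻ (proj₁ q∉)
      ... | inj₁ p∈ | inj₁ q∈ =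
        -- Old or new, `r` lies in a cone over `U`, so one separation argument covers both cases.
        cones-disjoint U-biclosed α∈U β∈U (Initial⊆X r∈) r∈Coneᵁ (Uᶜ p∉ p∈) (Uᶜ q∉ q∈) r∈Cone
      ... | inj₁ p∈ | inj₂ q-latest = mixed (Uᶜ p∉ p∈) q-latest q∉ r∈Cone r∈′
      ... | inj₂ p-latest | inj₁ q∈ = mixed (Uᶜ q∉ q∈) p-latest p∉ (Cone-swap r∈Cone) r∈′
      ... | inj₂ p-latest | inj₂ q-latest =
        -- As `p` and `q` coincide and `r` is nonzero, `p` is on the ray of `r` and inherits the
        -- generators `α` and `β`.
        proj₂ p∉ (proj₁ p∉ , α , β , α∈U , β∈U ,
          Cone-ray
            (Ray-sym (X⇒≉0 (Initial⊆X r∈)) (diagonal (Latest-unique q-latest p-latest) r∈Cone))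
            r∈Coneᵁ)

    extend-biclosed : IsBiclosed (Initial (ℕ.suc m)) (extend m U)
    extend-biclosed = extend-closed , proj₁ , extend-coclosed

  -- The closure as a limit of stages.

  module _ {m : ℕ} {U : Subset} (U-biclosed : IsBiclosed (Initial m) U) where

    private
      -- With `k` on the left, `ℕ.suc k ℕ.+ m` reduces to `ℕ.suc (k ℕ.+ m)`, so consecutive stages
      -- fit without a cast.
      stage : ℕ → Subset
      stage ℕ.zero    = U
      stage (ℕ.suc k) = extend (k ℕ.+ m) (stage k)

      stage-biclosed : ∀ k → IsBiclosed (Initial (k ℕ.+ m)) (stage k)
      stage-biclosed ℕ.zero    = U-biclosed
      stage-biclosed (ℕ.suc k) = extend-biclosed (stage-biclosed k)

      stage-mono : ∀ {k l} → k ℕ.≤′ l → stage k ⊆ stage l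
      stage-mono ℕ.≤′-refl                = id
      stage-mono (ℕ.≤′-step {l} k≤l) x∈ = ⊆extend (stage-biclosed l) (stage-mono k≤l x∈)

      -- No extension admits a vector of an earlier segment that was rejected before.
      stage-stable : ∀ {k l} → k ℕ.≤′ l → stage l ∩ Initial (k ℕ.+ m) ⊆ stage k
      stage-stable ℕ.≤′-refl                        = proj₁
      stage-stable (ℕ.≤′-step {l} k≤l) (x∈ , x∈ᵏ) = stage-stable k≤l
        (extend∩Initial⊆ (stage-biclosed l) (x∈ , Initial-mono (ℕ.+-monoˡ-≤ m (ℕ.≤′⇒≤ k≤l)) x∈ᵏ) , x∈ᵏ)

      U⊆X : U ⊆ X
      U⊆X x∈U = Initial⊆X (proj₁ (proj₁ U-biclosed) x∈U)

      closure : IsSmallestClosedContaining X U (Closure X U)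
      closure = closure-isSmallest U⊆X

      stage⊆Closure : ∀ k → stage k ⊆ Closure X U
      stage⊆Closure ℕ.zero    x∈U = base x∈U
      stage⊆Closure (ℕ.suc k) (x∈ , _ , _ , α∈ , β∈ , x∈Cone) =
        step (stage⊆Closure k α∈) (stage⊆Closure k β∈) (Cone⊆Span₊-pair x∈Cone , Initial⊆X x∈)

      -- An explicit form of the closure: closure steps generate every stage, and the union is
      -- closed, so minimality gives the other inclusion.
      Limit : Subset
      Limit x = ∃[ k ] x ∈ stage k

      Limit-closed : IsClosed X Limit
      Limit-closed = (λ { (k , x∈) → Initial⊆X (proj₁ (proj₁ (stage-biclosed k)) x∈) }) , limit-step
        where
        limit-step : ∀ {α β γ} → α ∈ Limit → β ∈ Limit → γ ∈ Span₊ (⟦ α ⟧ ∪ ⟦ β ⟧) ∩ X → γ ∈ Limit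
        limit-step (k , α∈) (l , β∈) (γ∈Span , γ∈X) with n , γ∈ ← X⊆Initial γ∈X =
          -- Stage `N` contains `α` and `β`, and its segment reaches far enough to contain `γ`.
          N , proj₂ (proj₁ (stage-biclosed N))
                (stage-mono (ℕ.≤⇒≤′ (ℕ.m≤n⇒m≤n⊔o n (ℕ.m≤m⊔n k l))) α∈)
                (stage-mono (ℕ.≤⇒≤′ (ℕ.m≤n⇒m≤n⊔o n (ℕ.m≤n⊔m k l))) β∈)
                (γ∈Span , Initial-mono (ℕ.m≤n⇒m≤n+o m (ℕ.m≤n⊔m (k ℕ.⊔ l) n)) γ∈)
          where N = k ℕ.⊔ l ℕ.⊔ n

      Closure⊆Limit : Closure X U ⊆ Limit
      Closure⊆Limit = proj₂ (proj₂ closure) Limit Limit-closed (ℕ.zero ,_)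

    closure∩Initial : Closure X U ∩ Initial m ≐ U
    closure∩Initial = ⇒ , λ x∈U → base x∈U , proj₁ (proj₁ U-biclosed) x∈U
      where
      ⇒ : Closure X U ∩ Initial m ⊆ U
      -- Stability is used from stage zero, which is `U` itself with segment `Initial m`.
      ⇒ (x∈ , x∈ᵐ) with k , x∈ᵏ ← Closure⊆Limit x∈ = stage-stable (ℕ.z≤′n {k}) (x∈ᵏ , x∈ᵐ)

    -- Coclosedness is tested at one stage that contains `γ` and whose segment contains `α` and `β`;
    -- these two are outside it because each stage lies in the closure.
    closure-biclosed : IsBiclosed X (Closure X U)
    closure-biclosed = proj₁ closure , proj₁ (proj₁ closure) , proj₁ ,
      λ { α∉ β∉ γ∈ → proj₂ γ∈ , λ γ∈C → coclosed α∉ β∉ γ∈ (Closure⊆Limit γ∈C) }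
      where
      coclosed : ∀ {α β γ} → α ∈ X ∖ Closure X U → β ∈ X ∖ Closure X U →
                 γ ∈ Span₊ (⟦ α ⟧ ∪ ⟦ β ⟧) ∩ X → γ ∉ Limit
      coclosed (α∈X , α∉) (β∈X , β∉) (γ∈Span , _) (k , γ∈)
        with a , α∈ ← X⊆Initial α∈X | b , β∈ ← X⊆Initial β∈X =
        proj₂ (proj₂ (proj₂ (proj₂ (stage-biclosed N)))
          (Initial-mono (ℕ.m≤n⇒m≤n+o m (ℕ.m≤n⇒m≤n⊔o k (ℕ.m≤m⊔n a b))) α∈ , α∉ ∘ stage⊆Closure N)
          (Initial-mono (ℕ.m≤n⇒m≤n+o m (ℕ.m≤n⇒m≤n⊔o k (ℕ.m≤n⊔m a b))) β∈ , β∉ ∘ stage⊆Closure N)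
          (γ∈Span , proj₁ (proj₁ (stage-biclosed N)) γ∈ᴺ)) γ∈ᴺ
        where
        N = a ℕ.⊔ b ℕ.⊔ k
        γ∈ᴺ = stage-mono (ℕ.≤⇒≤′ (ℕ.m≤n⊔m (a ℕ.⊔ b) k)) γ∈

theorem4p2 : ExcludedMiddle 0ℓ →
    (ℝ : RealNumbers) (V : RealVectorSpace ℝ) →
    let open Arrangement ℝ V in
    FiniteDimensional →
    (X : Subset) → Module.0ᴹ V ∉ X →
    PlanesHaveFundamentalVectors X →
    (γ : Ordering X) → Ordering.IsSuitable γ →
    (m : ℕ) (U : Subset) → IsBiclosed (Ordering.Initial γ m) U →
    IsBiclosed X (Closure X U) × Closure X U ∩ Ordering.Initial γ m ≐ U
theorem4p2 em ℝ V _ X 0∉X planes γ suitable m U U-biclosed =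
  closure-biclosed U-biclosed , closure∩Initial U-biclosed
  where open Extension em ℝ V X 0∉X planes γ suitable
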